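{- Let $G$ be a $\lambda''$-connected super-$\lambda'$ graph. Write $\lambda''=\lambda''(G)$, $\xi=\xi(G)$ and $\delta=\delta(G)$ (the minimum vertex-degree of $G$). Then (i) $\rho'(G)\geqslant \min\{\lambda''-\xi-1,\ \delta-1\}$ if $\eta(G)\geqslant \delta$; (ii) $\rho'(G)\geqslant \min\{\lambda''-\xi,\ \delta-1\}$ if $G$ is edge-regular.
   Context: All graphs are finite and simple. For a connected graph $G=(V,E)$ and an integer $h\geqslant 0$, a set $F\subseteq E(G)$ is an $h$-extra edge-cut if $G-F$ is disconnected and every component of $G-F$ has more than $h$ vertices. If such a set exists, $\lambda^{(h)}(G)$ is the minimum cardinality of an $h$-extra edge-cut, and $G$ is called $\lambda^{(h)}$-connected. A $\lambda^{(h)}$-cut is an $h$-extra edge-cut of cardinality $\lambda^{(h)}(G)$. Write $\lambda'=\lambda^{(1)}$ and $\lambda''=\lambda^{(2)}$. For an edge $xy$ of $G$, its edge-degree is $d_G(\{x,y\})=d_G(x)+d_G(y)-2$; $\xi(G)$ is the minimum edge-degree of $G$, $\eta(G)$ is the number of edges of $G$ with edge-degree $\xi(G)$, and $G$ is edge-regular if every edge of $G$ has edge-degree $\xi(G)$. A $\lambda'$-connected graph $G$ is super-$\lambda'$ if $\lambda'(G)=\xi(G)$ and, for every $\lambda'$-cut $F$ of $G$, some component of $G-F$ has exactly $2$ vertices. A disconnected graph is not super-$\lambda'$. For a super-$\lambda'$ graph $G$, the persistence $\rho'(G)$ is the maximum integer $m$ such that $G-F$ is still super-$\lambda'$ for every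 $F\subseteq E(G)$ with $|F|\leqslant m$. -}

module Defs where

open import Data.Bool using (Bool; true; false; not; _∧_; T)
open import Data.Bool.Properties using (T?)
open import Data.Fin using (Fin; _<?_)
open import Data.Fin.Subset using (Subset; ∣_∣; _∈_)
open import Data.List using (List; []; _∷_; length; map; filter; allFin; cartesianProduct)
open import Data.List.Extrema.Nat using (min)
open import Data.Nat using (ℕ; _+_; _∸_; _≤_; _<_; _≟_)
open import Data.Product using (∃; _×_; _,_)
open import Data.Vec using (tabulate)
open import Function.Bundles using (_⇔_)
open import Relation.Binary.Construct.Closure.ReflexiveTransitive using (Star)
open import Relation.Binary.PropositionalEquality using (_≡_; cong₂; cong)
open import Relation.Nullary using (¬_)
open import Relation.Nullary.Decidable using (_×-dec_)

record Graph (n : ℕ) : Set where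
  field
    adj        : Fin n → Fin n → Bool
    adj-sym    : ∀ u v → adj u v ≡ adj v u
    adj-irrefl : ∀ v → adj v v ≡ false

  Adj : Fin n → Fin n → Set
  Adj u v = T (adj u v)

open Graph public

private
  variable
    n : ℕ

-- Each edge is listed exactly once, as the pair (u , v) with u < v.
edges : Graph n → List (Fin n × Fin n)
edges {n} G =
  filter (λ (u , v) → (u <? v) ×-dec T? (adj G u v))
         (cartesianProduct (allFin n) (allFin n))

size : Graph n → ℕ
size G = length (edges G)

-- A set F of edges of G is represented by the graph, on the same vertices,
-- having exactly the members of F as edges; its cardinality is size F.
_⊆ᴱ_ : Graph n → Graph n → Set
F ⊆ᴱ G = ∀ u v → Adj F u v → Adj G u v

infixl 6 _─_
_─_ : Graph n → Graph n → Graph n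
adj        (G ─ F) u v = adj G u v ∧ not (adj F u v)
adj-sym    (G ─ F) u v = cong₂ (λ a b → a ∧ not b) (adj-sym G u v) (adj-sym F u v)
adj-irrefl (G ─ F) v   = cong (_∧ not (adj F v v)) (adj-irrefl G v)

degree : Graph n → Fin n → ℕ
degree G v = ∣ tabulate (adj G v) ∣

-- On an edge both degrees are positive, so the subtraction is exact.
edgeDegree : Graph n → Fin n × Fin n → ℕ
edgeDegree G (u , v) = degree G u + degree G v ∸ 2

-- The value on the empty list is a dummy.
minimum : List ℕ → ℕ
minimum []       = 0
minimum (x ∷ xs) = min x xs

δ : Graph n → ℕ
δ {n} G = minimum (map (degree G) (allFin n))

ξ : Graph n → ℕ
ξ G = minimum (map (edgeDegree G) (edges G))

η : Graph n → ℕ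
η G = length (filter (λ e → edgeDegree G e ≟ ξ G) (edges G))

EdgeRegular : Graph n → Set
EdgeRegular G = ∀ u v → Adj G u v → edgeDegree G (u , v) ≡ ξ G

Connected : Graph n → Set
Connected G = ∀ u v → Star (Adj G) u v

IsComponent : Graph n → Subset n → Set
IsComponent G C = ∃ λ v → ∀ u → (u ∈ C) ⇔ Star (Adj G) v u

record IsExtraEdgeCut (h : ℕ) (G F : Graph n) : Set where
  field
    subset       : F ⊆ᴱ G
    disconnected : ¬ Connected (G ─ F)
    large        : ∀ C → IsComponent (G ─ F) C → h < ∣ C ∣

λ⟨_⟩-Connected : ℕ → Graph n → Set
λ⟨ h ⟩-Connected G = Connected G × ∃ λ F → IsExtraEdgeCut h G F

-- λ⟨ h ⟩ G ≔ k states that k is the minimum cardinality of an h-extra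
-- edge-cut of G; no such k exists when G has no h-extra edge-cut.
λ⟨_⟩_≔_ : ℕ → Graph n → ℕ → Set
λ⟨ h ⟩ G ≔ k =
  (∃ λ F → IsExtraEdgeCut h G F × size F ≡ k) ×
  (∀ F → IsExtraEdgeCut h G F → k ≤ size F)

IsλCut : ℕ → (G F : Graph n) → Set
IsλCut h G F = IsExtraEdgeCut h G F × λ⟨ h ⟩ G ≔ size F

record Super-λ′ (G : Graph n) : Set where
  field
    λ′-connected : λ⟨ 1 ⟩-Connected G
    λ′≡ξ         : λ⟨ 1 ⟩ G ≔ ξ G
    isolatesEdge : ∀ F → IsλCut 1 G F → ∃ λ C → IsComponent (G ─ F) C × ∣ C ∣ ≡ 2

Persists : Graph n → ℕ → Set
Persists G m = ∀ F → F ⊆ᴱ G → size F ≤ m → Super-λ′ (G ─ F)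

-- ρ′ G ≔ r states that r is the largest m with Persists G m.
ρ′_≔_ : Graph n → ℕ → Set
ρ′ G ≔ r = Persists G r × (∀ m → Persists G m → m ≤ r)

{-# OPTIONS --safe #-}
-- Let H = G ─ F with |F| < δ and |F| + ξ(H) < λ″; both hypotheses of the theorem
-- give this inequality.  For a 1-extra cut S of H, either some component of H ─ S
-- has two vertices, and then S contains all edges leaving it, so |S| ≥ ξ(H); or all
-- components have at least three, and then F ∪ S is a 2-extra cut of G, so
-- |S| ≥ λ″ − |F| > ξ(H).  Conversely, if u v is an edge of H of minimum edge-degree
-- and some edge of H avoids u and v, then the edges at u v contain a 1-extra cut.
-- If no edge avoids both of them, some edge still avoids each one, because |F| < δ;
-- minimality then bounds their degrees by 2, so that there are at most 4 vertices,
-- whereas a 2-extra cut requires 6.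

module Submission where

open import Data.Bool using (Bool; true; false; _∧_; _∨_; _xor_; T; if_then_else_) renaming (_≟_ to _≟ᵇ_)
open import Data.Bool.Properties using (T?; T-∧; T-∨; T-≡; xor-comm)
open import Data.Fin using (Fin; zero; suc; _<?_; _≟_) renaming (_<_ to _<ᶠ_)
open import Data.Fin.Properties using (any?; all?; ¬∀⟶∃¬; suc-injective; <-asym; ≤∧≢⇒<)
open import Data.Fin.Subset using (Subset; ∣_∣; _∈_; inside; outside)
open import Data.Fin.Subset.Properties using (⊆-antisym)
open import Data.Integer using (+_; -[1+_]; _-_; _⊓_; _≤_; 1ℤ; +≤+; -≤+; -_)
  renaming (_+_ to _+ᶻ_)
import Data.Integer.Properties as ℤ
open import Data.List using (List; []; _∷_; _++_; length; map; filter; allFin; cartesianProduct)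
open import Data.List.Extrema.Nat using (min≤⊤; min≤xs; argmin-sel)
open import Data.List.Membership.Propositional using () renaming (_∈_ to _∈ˡ_; _∉_ to _∉ˡ_)
import Data.List.Membership.DecPropositional as DecMembership
open import Data.List.Membership.Propositional.Properties
  using (∈-map⁺; ∈-map⁻; ∈-++⁺ˡ; ∈-++⁺ʳ; ∈-++⁻; ∈-filter⁺; ∈-filter⁻; ∈-cartesianProduct⁺; ∈-allFin)
open import Data.List.Properties using (length-map; length-++; length-removeAt′; length-tabulate)
open import Data.List.Relation.Binary.Disjoint.Propositional using (Disjoint)
import Data.List.Relation.Unary.All as All
open import Data.List.Relation.Unary.All.Properties using (¬Any⇒All¬)
open import Data.List.Relation.Unary.AllPairs using ([]; _∷_)
open import Data.List.Relation.Unary.Any using (here; there; index; _─_)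
open import Data.List.Relation.Unary.Unique.Propositional using (Unique)
import Data.List.Relation.Unary.Unique.Propositional.Properties as Unique
open import Data.Nat using (ℕ; suc; z≤n; s≤s; _≥_; _+_; _∸_; _<_) renaming (_≤_ to _≤ⁿ_)
import Data.Nat as ℕ
import Data.Nat.Properties as ℕ
open import Data.Product using (∃; ∃₂; _×_; _,_; proj₁; proj₂)
open import Data.Sum using (_⊎_; inj₁; inj₂; [_,_]′)
open import Data.Vec using (tabulate; []; _∷_; here; there)
open import Data.Vec.Properties using (lookup∘tabulate; []=⇒lookup; lookup⇒[]=)
open import Function using (_∘_; id; case_of_)
open import Function.Bundles using (_⇔_; mk⇔; Equivalence)
open import Relation.Binary.Construct.Closure.ReflexiveTransitive using (Star; ε; _◅_; _◅◅_; reverse)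
import Relation.Binary.Construct.Closure.ReflexiveTransitive as Star
open import Relation.Binary.PropositionalEquality using (_≡_; _≢_; refl; sym; trans; cong; cong₂; subst)
open import Relation.Nullary using (¬_; Dec; yes; no; does; contradiction)
open import Relation.Nullary.Decidable using (_×-dec_; _⊎-dec_; ¬?; map′; dec-true; dec-false;
         toWitness; fromWitness; decidable-stable; ⌊_⌋)
open import Relation.Unary using (Decidable)
open import Defs hiding (_─_)
open import Defs using () renaming (_─_ to _─ᴱ_)

open Equivalence using (to; from)

-- Counting

module _ {A : Set} where

  ∈-removeAt : ∀ {x z : A} {ys} (x∈ys : x ∈ˡ ys) → z ∈ˡ ys → z ≢ x → z ∈ˡ (ys ─ x∈ys)
  ∈-removeAt (here refl)  (here refl)  z≢x = contradiction refl z≢x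
  ∈-removeAt (here refl)  (there z∈ys) z≢x = z∈ys
  ∈-removeAt (there x∈ys) (here refl)  z≢x = here refl
  ∈-removeAt (there x∈ys) (there z∈ys) z≢x = there (∈-removeAt x∈ys z∈ys z≢x)

  -- Each element of `xs` is removed once from `ys`, and uniqueness keeps the rest of `xs` inside
  -- the shortened list. Cardinalities are compared below through such inclusions, with only the
  -- smaller list required to be free of repetitions.
  length-mono-⊆ : ∀ {xs ys : List A} → Unique xs → (∀ {z} → z ∈ˡ xs → z ∈ˡ ys) →
                  length xs ≤ⁿ length ys
  length-mono-⊆ []                          xs⊆ys = z≤n
  length-mono-⊆ {x ∷ xs} {ys} (x∉xs ∷ uniq) xs⊆ys =
    subst (suc (length xs) ≤ⁿ_) (sym (length-removeAt′ ys (index x∈ys)))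
      (s≤s (length-mono-⊆ uniq λ z∈xs →
        ∈-removeAt x∈ys (xs⊆ys (there z∈xs)) (All.lookup x∉xs z∈xs ∘ sym)))
    where x∈ys = xs⊆ys (here refl)

  ∉⇒Unique-∷ : ∀ {x : A} {xs} → x ∉ˡ xs → Unique xs → Unique (x ∷ xs)
  ∉⇒Unique-∷ x∉xs uniq = ¬Any⇒All¬ _ x∉xs ∷ uniq

  length-positive : ∀ {xs : List A} → 0 < length xs → ∃ (_∈ˡ xs)
  length-positive {x ∷ xs} _ = x , here refl

-- The membership premise excludes the empty list, on which `minimum` takes its dummy value.
minimum-∈ : ∀ {x xs} → x ∈ˡ xs → minimum xs ∈ˡ xs
minimum-∈ {xs = y ∷ ys} _ = [ here , there ]′ (argmin-sel id y ys)

minimum-≤ : ∀ {x xs} → x ∈ˡ xs → minimum xs ≤ⁿ x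
minimum-≤ {xs = y ∷ ys} (here refl)  = min≤⊤ y ys
minimum-≤ {xs = y ∷ ys} (there x∈ys) = All.lookup (min≤xs y ys) x∈ys

members : ∀ {n} → Subset n → List (Fin n)
members []            = []
members (inside  ∷ p) = zero ∷ map suc (members p)
members (outside ∷ p) = map suc (members p)

length-members : ∀ {n} (p : Subset n) → length (members p) ≡ ∣ p ∣
length-members []            = refl
length-members (inside  ∷ p) = cong suc (trans (length-map suc (members p)) (length-members p))
length-members (outside ∷ p) = trans (length-map suc (members p)) (length-members p)

∈-members⁺ : ∀ {n} {p : Subset n} {x} → x ∈ p → x ∈ˡ members p
∈-members⁺ here                           = here refl
∈-members⁺ {p = inside  ∷ p} (there x∈p) = there (∈-map⁺ suc (∈-members⁺ x∈p))
∈-members⁺ {p = outside ∷ p} (there x∈p) = ∈-map⁺ suc (∈-members⁺ x∈p)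

∈-members⁻ : ∀ {n} {p : Subset n} {x} → x ∈ˡ members p → x ∈ p
∈-members⁻ {p = inside  ∷ p} (here refl) = here
∈-members⁻ {p = inside  ∷ p} (there x∈) with _ , y∈ , refl ← ∈-map⁻ suc x∈ = there (∈-members⁻ y∈)
∈-members⁻ {p = outside ∷ p} x∈         with _ , y∈ , refl ← ∈-map⁻ suc x∈ = there (∈-members⁻ y∈)

members-unique : ∀ {n} (p : Subset n) → Unique (members p)
members-unique []            = []
members-unique (inside  ∷ p) =
  ∉⇒Unique-∷ (λ 0∈ → case ∈-map⁻ suc 0∈ of λ ()) (Unique.map⁺ suc-injective (members-unique p))
members-unique (outside ∷ p) = Unique.map⁺ suc-injective (members-unique p)

∈-tabulate : ∀ {n} {f : Fin n → Bool} {x} → x ∈ tabulate f ⇔ T (f x)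
∈-tabulate {f = f} {x} = mk⇔
  (λ x∈ → from T-≡ (trans (sym (lookup∘tabulate f x)) ([]=⇒lookup x∈)))
  (λ fx → lookup⇒[]= x _ (trans (lookup∘tabulate f x) (to T-≡ fx)))

length≤∣∣ : ∀ {n} {xs} (C : Subset n) → Unique xs → (∀ {z} → z ∈ˡ xs → z ∈ C) → length xs ≤ⁿ ∣ C ∣
length≤∣∣ C uniq xs⊆C =
  subst (_ ≤ⁿ_) (length-members C) (length-mono-⊆ uniq (∈-members⁺ ∘ xs⊆C))

∣∣≤length : ∀ {n} {xs} (C : Subset n) → (∀ {z} → z ∈ C → z ∈ˡ xs) → ∣ C ∣ ≤ⁿ length xs
∣∣≤length C C⊆xs =
  subst (_≤ⁿ _) (length-members C) (length-mono-⊆ (members-unique C) (C⊆xs ∘ ∈-members⁻))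

order≤length : ∀ {n} {xs : List (Fin n)} → (∀ z → z ∈ˡ xs) → n ≤ⁿ length xs
order≤length {n} {xs} all∈ = subst (_≤ⁿ length xs) (length-tabulate {n = n} id)
  (length-mono-⊆ (Unique.allFin⁺ _) (λ _ → all∈ _))

length≤order : ∀ {n} {xs : List (Fin n)} → Unique xs → length xs ≤ⁿ n
length≤order {n} {xs} uniq = subst (length xs ≤ⁿ_) (length-tabulate {n = n} id)
  (length-mono-⊆ uniq (λ _ → ∈-allFin _))

-- Edges and degrees

module _ {n : ℕ} where

  Adj-sym : ∀ (G : Graph n) {u v} → Adj G u v → Adj G v u
  Adj-sym G = subst T (adj-sym G _ _)

  Adj⇒≢ : ∀ (G : Graph n) {u v} → Adj G u v → u ≢ v
  Adj⇒≢ G {u} uv refl = subst T (adj-irrefl G u) uv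

  ─-adj⁺ : ∀ (G F : Graph n) {u v} → Adj G u v → ¬ Adj F u v → Adj (G ─ᴱ F) u v
  ─-adj⁺ G F {u} {v} uv ¬uv with adj F u v
  ... | true  = contradiction _ ¬uv
  ... | false = from T-∧ (uv , _)

  ─-adj⁻ : ∀ (G F : Graph n) {u v} → Adj (G ─ᴱ F) u v → Adj G u v × ¬ Adj F u v
  ─-adj⁻ G F {u} {v} uv with adj G u v | adj F u v
  ... | true | false = _ , λ ()

  infixl 6 _∪ᴱ_
  _∪ᴱ_ : Graph n → Graph n → Graph n
  adj        (F ∪ᴱ S) u v = adj F u v ∨ adj S u v
  adj-sym    (F ∪ᴱ S) u v = cong₂ _∨_ (adj-sym F u v) (adj-sym S u v)
  adj-irrefl (F ∪ᴱ S) v   = cong₂ _∨_ (adj-irrefl F v) (adj-irrefl S v)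

  boundary : Graph n → (Fin n → Bool) → Graph n
  adj        (boundary G c) u v = adj G u v ∧ (c u xor c v)
  adj-sym    (boundary G c) u v =
    cong₂ _∧_ (adj-sym G u v) (xor-comm (c u) (c v))
  adj-irrefl (boundary G c) v   = cong (_∧ (c v xor c v)) (adj-irrefl G v)

  boundary-adj⁻ : ∀ G c {u v} → Adj (boundary G c) u v → Adj G u v × c u ≢ c v
  boundary-adj⁻ G c {u} {v} uv with adj G u v | c u | c v
  ... | true | true  | false = _ , λ ()
  ... | true | false | true  = _ , λ ()

  boundary-adj⁺ : ∀ G c {u v} → Adj G u v → c u ≢ c v → Adj (boundary G c) u v
  boundary-adj⁺ G c {u} {v} uv cu≢cv with adj G u v | c u | c v
  ... | true | true  | true  = contradiction refl cu≢cv
  ... | true | true  | false = _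
  ... | true | false | true  = _
  ... | true | false | false = contradiction refl cu≢cv

  neighbours : Graph n → Fin n → List (Fin n)
  neighbours G v = members (tabulate (adj G v))

  length-neighbours : ∀ G v → length (neighbours G v) ≡ degree G v
  length-neighbours G v = length-members (tabulate (adj G v))

  neighbours-unique : ∀ G v → Unique (neighbours G v)
  neighbours-unique G v = members-unique (tabulate (adj G v))

  ∈-neighbours⁺ : ∀ G {v w} → Adj G v w → w ∈ˡ neighbours G v
  ∈-neighbours⁺ G vw = ∈-members⁺ (from ∈-tabulate vw)

  ∈-neighbours⁻ : ∀ G {v w} → w ∈ˡ neighbours G v → Adj G v w
  ∈-neighbours⁻ G w∈ = to ∈-tabulate (∈-members⁻ w∈)

  degree≤ : ∀ G v {xs} → (∀ {w} → Adj G v w → w ∈ˡ xs) → degree G v ≤ⁿ length xs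
  degree≤ G v N⊆xs = subst (_≤ⁿ _) (length-neighbours G v)
    (length-mono-⊆ (neighbours-unique G v) (N⊆xs ∘ ∈-neighbours⁻ G))

  ≤degree : ∀ G v {xs} → Unique xs → (∀ {w} → w ∈ˡ xs → Adj G v w) → length xs ≤ⁿ degree G v
  ≤degree G v uniq xs⊆N = subst (_ ≤ⁿ_) (length-neighbours G v)
    (length-mono-⊆ uniq (∈-neighbours⁺ G ∘ xs⊆N))

  degree-mono : ∀ G H v → (∀ {w} → Adj G v w → Adj H v w) → degree G v ≤ⁿ degree H v
  degree-mono G H v G⊆H = subst (degree G v ≤ⁿ_) (length-neighbours H v)
    (degree≤ G v (∈-neighbours⁺ H ∘ G⊆H))

  degree-mono-< : ∀ G H {v u} → (∀ {w} → Adj G v w → Adj H v w) → ¬ Adj G v u → Adj H v u →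
                  degree G v < degree H v
  degree-mono-< G H {v} {u} G⊆H ¬vu vu = subst (λ k → suc k ≤ⁿ _) (length-neighbours G v)
    (≤degree H v (∉⇒Unique-∷ (¬vu ∘ ∈-neighbours⁻ G) (neighbours-unique G v))
      λ { (here refl) → vu ; (there w∈) → G⊆H (∈-neighbours⁻ G w∈) })

  degree≤suc : ∀ G H {v u} → (∀ {w} → Adj G v w → w ≢ u → Adj H v w) →
               degree G v ≤ⁿ suc (degree H v)
  degree≤suc G H {v} {u} G⊆H+u = subst (λ k → _ ≤ⁿ suc k) (length-neighbours H v)
    (degree≤ G v λ {w} vw → case w ≟ u of λ
      { (yes refl) → here refl
      ; (no w≢u)   → there (∈-neighbours⁺ H (G⊆H+u vw w≢u)) })

  degree≤degree─+degree : ∀ (G F : Graph n) v → degree G v ≤ⁿ degree (G ─ᴱ F) v + degree F v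
  degree≤degree─+degree G F v = subst (degree G v ≤ⁿ_) len (degree≤ G v split)
    where
    len : length (neighbours (G ─ᴱ F) v ++ neighbours F v) ≡ degree (G ─ᴱ F) v + degree F v
    len = trans (length-++ (neighbours (G ─ᴱ F) v))
      (cong₂ _+_ (length-neighbours (G ─ᴱ F) v) (length-neighbours F v))
    split : ∀ {w} → Adj G v w → w ∈ˡ neighbours (G ─ᴱ F) v ++ neighbours F v
    split {w} vw with T? (adj F v w)
    ... | yes f = ∈-++⁺ʳ (neighbours (G ─ᴱ F) v) (∈-neighbours⁺ F f)
    ... | no ¬f = ∈-++⁺ˡ (∈-neighbours⁺ (G ─ᴱ F) (─-adj⁺ G F vw ¬f))

  positive-degree⇒neighbour : ∀ G v → 0 < degree G v → ∃ (Adj G v)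
  positive-degree⇒neighbour G v 0<d
    with w , w∈ ← length-positive (subst (0 <_) (sym (length-neighbours G v)) 0<d) = w , ∈-neighbours⁻ G w∈

  neighbour⇒positive-degree : ∀ G {v w} → Adj G v w → 0 < degree G v
  neighbour⇒positive-degree G {v} vw =
    ≤degree G v (∉⇒Unique-∷ (λ ()) []) λ { (here refl) → vw }

  -- The form in which `edges` lists an unordered pair of distinct vertices: smaller end first.
  edge : Fin n → Fin n → Fin n × Fin n
  edge u v = if does (u <? v) then (u , v) else (v , u)

  edge-< : ∀ {u v} → u <ᶠ v → edge u v ≡ (u , v)
  edge-< {u} {v} u<v rewrite dec-true (u <? v) u<v = refl

  edge-> : ∀ {u v} → v <ᶠ u → edge u v ≡ (v , u)
  edge-> {u} {v} v<u rewrite dec-false (u <? v) (<-asym v<u) = refl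

  edge-injective : ∀ {u v x y} → edge u v ≡ edge x y → (u ≡ x × v ≡ y) ⊎ (u ≡ y × v ≡ x)
  edge-injective {u} {v} {x} {y} eq with does (u <? v) | does (x <? y)
  edge-injective refl | true  | true  = inj₁ (refl , refl)
  edge-injective refl | true  | false = inj₂ (refl , refl)
  edge-injective refl | false | true  = inj₂ (refl , refl)
  edge-injective refl | false | false = inj₁ (refl , refl)

  edge-injectiveʳ : ∀ {u v w} → edge u v ≡ edge u w → v ≡ w
  edge-injectiveʳ eq with edge-injective eq
  ... | inj₁ (_ , v≡w)   = v≡w
  ... | inj₂ (u≡w , v≡u) = trans v≡u u≡w

  isEdge? : ∀ (G : Graph n) → Decidable {A = Fin n × Fin n} (λ (u , v) → u <ᶠ v × Adj G u v)
  isEdge? G (u , v) = (u <? v) ×-dec T? (adj G u v)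

  ∈-edges⁺ : ∀ (G : Graph n) {u v} → u <ᶠ v → Adj G u v → (u , v) ∈ˡ edges G
  ∈-edges⁺ G u<v uv =
    ∈-filter⁺ (isEdge? G) (∈-cartesianProduct⁺ (∈-allFin _) (∈-allFin _)) (u<v , uv)

  ∈-edges⁻ : ∀ (G : Graph n) {u v} → (u , v) ∈ˡ edges G → u <ᶠ v × Adj G u v
  ∈-edges⁻ G uv∈ = proj₂ (∈-filter⁻ (isEdge? G) {xs = cartesianProduct (allFin n) (allFin n)} uv∈)

  edges-unique : ∀ (G : Graph n) → Unique (edges G)
  edges-unique G = Unique.filter⁺ (isEdge? G) (Unique.cartesianProduct⁺ (Unique.allFin⁺ n) (Unique.allFin⁺ n))

  ≢⇒<⊎> : ∀ {u v : Fin n} → u ≢ v → u <ᶠ v ⊎ v <ᶠ u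
  ≢⇒<⊎> {u} {v} u≢v with u <? v
  ... | yes u<v = inj₁ u<v
  ... | no  u≮v = inj₂ (≤∧≢⇒< (ℕ.≮⇒≥ u≮v) (u≢v ∘ sym))

  edge-∈ : ∀ G {u v} → Adj G u v → edge u v ∈ˡ edges G
  edge-∈ G {u} {v} uv with ≢⇒<⊎> (Adj⇒≢ G uv)
  ... | inj₁ u<v = subst (_∈ˡ edges G) (sym (edge-< u<v)) (∈-edges⁺ G u<v uv)
  ... | inj₂ v<u = subst (_∈ˡ edges G) (sym (edge-> v<u)) (∈-edges⁺ G v<u (Adj-sym G uv))

  -- Counting edges through the stars of vertices

  star : Graph n → Fin n → List (Fin n × Fin n)
  star G v = map (edge v) (neighbours G v)

  ∈-star⁺ : ∀ G {v w} → Adj G v w → edge v w ∈ˡ star G v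
  ∈-star⁺ G vw = ∈-map⁺ (edge _) (∈-neighbours⁺ G vw)

  ∈-star⁻ : ∀ G {v e} → e ∈ˡ star G v → ∃ λ w → Adj G v w × e ≡ edge v w
  ∈-star⁻ G e∈ with w , w∈ , eq ← ∈-map⁻ (edge _) e∈ = w , ∈-neighbours⁻ G w∈ , eq

  star⊆edges : ∀ G {v e} → e ∈ˡ star G v → e ∈ˡ edges G
  star⊆edges G e∈ with _ , vw , refl ← ∈-star⁻ G e∈ = edge-∈ G vw

  star-unique : ∀ G v → Unique (star G v)
  star-unique G v = Unique.map⁺ edge-injectiveʳ (neighbours-unique G v)

  length-star : ∀ G v → length (star G v) ≡ degree G v
  length-star G v = trans (length-map (edge v) (neighbours G v)) (length-neighbours G v)

  length-star++star : ∀ G u v → length (star G u ++ star G v) ≡ degree G u + degree G v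
  length-star++star G u v = trans (length-++ (star G u))
    (cong₂ _+_ (length-star G u) (length-star G v))

  degree≤size : ∀ G v → degree G v ≤ⁿ size G
  degree≤size G v = subst (_≤ⁿ size G) (length-star G v)
    (length-mono-⊆ (star-unique G v) (star⊆edges G))

  -- The edge `x y` is one more edge, outside the star of `v`.
  degree<size : ∀ G {v x y} → Adj G x y → v ≢ x → v ≢ y → degree G v < size G
  degree<size G {v} {x} {y} xy v≢x v≢y = subst (λ k → suc k ≤ⁿ size G) (length-star G v)
    (length-mono-⊆ (∉⇒Unique-∷ xy∉star (star-unique G v))
      λ { (here refl) → edge-∈ G xy ; (there e∈) → star⊆edges G e∈ })
    where
    xy∉star : edge x y ∉ˡ star G v
    xy∉star e∈ with ∈-star⁻ G e∈
    ... | _ , _ , eq with edge-injective eq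
    ...   | inj₁ (x≡v , _) = v≢x (sym x≡v)
    ...   | inj₂ (_ , y≡v) = v≢y (sym y≡v)

  -- An edge common to both stars could only be `u v` itself, so the stars are disjoint.
  degree+degree≤size : ∀ G {u v} → u ≢ v → ¬ Adj G u v → degree G u + degree G v ≤ⁿ size G
  degree+degree≤size G {u} {v} u≢v ¬uv = subst (_≤ⁿ size G) (length-star++star G u v)
    (length-mono-⊆ (Unique.++⁺ (star-unique G u) (star-unique G v) disjoint)
      ([ star⊆edges G , star⊆edges G ]′ ∘ ∈-++⁻ (star G u)))
    where
    disjoint : Disjoint (star G u) (star G v)
    disjoint (e∈u , e∈v) with ∈-star⁻ G e∈u
    ... | _ , ux , refl with ∈-star⁻ G e∈v
    ...   | _ , _ , eq with edge-injective eq
    ...     | inj₁ (u≡v , _)    = u≢v u≡v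
    ...     | inj₂ (_ , refl) = ¬uv ux

  Outside : Fin n → Fin n → Fin n → Set
  Outside u v z = z ≢ u × z ≢ v

  outside? : ∀ u v z → Dec (Outside u v z)
  outside? u v z = ¬? (z ≟ u) ×-dec ¬? (z ≟ v)

  ¬Outside⇒ : ∀ {u v z} → ¬ Outside u v z → z ≡ u ⊎ z ≡ v
  ¬Outside⇒ {u} {v} {z} ¬out = decidable-stable ((z ≟ u) ⊎-dec (z ≟ v))
    λ neither → ¬out ((neither ∘ inj₁) , (neither ∘ inj₂))

  -- The premise says that every edge has an end in {`u`, `v`}, so the two stars cover all edges.
  size≤degree+degree : ∀ G {u v} → (∀ {x y} → Adj G x y → Outside u v x → ¬ Outside u v y) →
                       size G ≤ⁿ degree G u + degree G v
  size≤degree+degree G {u} {v} meets = subst (size G ≤ⁿ_) (length-star++star G u v)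
    (length-mono-⊆ (edges-unique G) covered)
    where
    at-end : ∀ {e x} → e ∈ˡ star G x → x ≡ u ⊎ x ≡ v → e ∈ˡ star G u ++ star G v
    at-end e∈ (inj₁ refl) = ∈-++⁺ˡ e∈
    at-end e∈ (inj₂ refl) = ∈-++⁺ʳ (star G u) e∈
    covered : ∀ {e} → e ∈ˡ edges G → e ∈ˡ star G u ++ star G v
    covered {x , y} xy∈ with ∈-edges⁻ G xy∈ | outside? u v x
    ... | x<y , xy | no ¬out-x  = at-end (subst (_∈ˡ star G x) (edge-< x<y) (∈-star⁺ G xy)) (¬Outside⇒ ¬out-x)
    ... | x<y , xy | yes out-x =
      at-end (subst (_∈ˡ star G y) (edge-> x<y) (∈-star⁺ G (Adj-sym G xy))) (¬Outside⇒ (meets xy out-x))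

  size-∪≤ : ∀ (F S : Graph n) → size (F ∪ᴱ S) ≤ⁿ size F + size S
  size-∪≤ F S = subst (size (F ∪ᴱ S) ≤ⁿ_) (length-++ (edges F))
    (length-mono-⊆ (edges-unique (F ∪ᴱ S)) split)
    where
    split : ∀ {e} → e ∈ˡ edges (F ∪ᴱ S) → e ∈ˡ edges F ++ edges S
    split {u , v} uv∈ with ∈-edges⁻ (F ∪ᴱ S) uv∈
    ... | u<v , uv with to (T-∨ {adj F u v}) uv
    ...   | inj₁ uvF = ∈-++⁺ˡ (∈-edges⁺ F u<v uvF)
    ...   | inj₂ uvS = ∈-++⁺ʳ (edges F) (∈-edges⁺ S u<v uvS)

  Adj⇒0<size : ∀ G {u v} → Adj G u v → 0 < size G
  Adj⇒0<size G {u} uv = ℕ.≤-trans (neighbour⇒positive-degree G uv) (degree≤size G u)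

  δ≤degree : ∀ (G : Graph n) v → δ G ≤ⁿ degree G v
  δ≤degree G v = minimum-≤ (∈-map⁺ (degree G) (∈-allFin v))

  ξ≤edgeDegree : ∀ (G : Graph n) {u v} → Adj G u v → ξ G ≤ⁿ edgeDegree G (u , v)
  ξ≤edgeDegree G {u} {v} uv with ≢⇒<⊎> (Adj⇒≢ G uv)
  ... | inj₁ u<v = minimum-≤ (∈-map⁺ (edgeDegree G) (∈-edges⁺ G u<v uv))
  ... | inj₂ v<u = subst (ξ G ≤ⁿ_) (cong (_∸ 2) (ℕ.+-comm (degree G v) (degree G u)))
                     (minimum-≤ (∈-map⁺ (edgeDegree G) (∈-edges⁺ G v<u (Adj-sym G uv))))

  ξ-attained : ∀ (G : Graph n) {x y} → Adj G x y → ∃₂ λ u v → Adj G u v × edgeDegree G (u , v) ≡ ξ G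
  ξ-attained G xy with ∈-map⁻ (edgeDegree G) (minimum-∈ (∈-map⁺ (edgeDegree G) (edge-∈ G xy)))
  ... | (u , v) , uv∈ , eq = u , v , proj₂ (∈-edges⁻ G uv∈) , sym eq

-- Connectivity

module Reachability {n : ℕ} (G : Graph n) where

  -- Warshall's algorithm: Via ws u v says that v is reached from u through
  -- intermediate vertices from ws.
  Via : List (Fin n) → Fin n → Fin n → Set
  Via []       u v = u ≡ v ⊎ Adj G u v
  Via (w ∷ ws) u v = Via ws u v ⊎ (Via ws u w × Via ws w v)

  via? : ∀ ws u v → Dec (Via ws u v)
  via? []       u v = (u ≟ v) ⊎-dec T? (adj G u v)
  via? (w ∷ ws) u v = via? ws u v ⊎-dec (via? ws u w ×-dec via? ws w v)

  Via⇒Star : ∀ ws {u v} → Via ws u v → Star (Adj G) u v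
  Via⇒Star []       (inj₁ refl)    = ε
  Via⇒Star []       (inj₂ uv)      = uv ◅ ε
  Via⇒Star (w ∷ ws) (inj₁ p)       = Via⇒Star ws p
  Via⇒Star (w ∷ ws) (inj₂ (p , q)) = Via⇒Star ws p ◅◅ Via⇒Star ws q

  Via-weaken : ∀ ws {u v} → Via [] u v → Via ws u v
  Via-weaken []       p = p
  Via-weaken (w ∷ ws) p = inj₁ (Via-weaken ws p)

  -- When both halves pass through the head of the list, only the part before the visit in the first
  -- half and the part after the visit in the second are kept; the detour between them is discarded.
  Via-trans : ∀ {ws u w v} → w ∈ˡ ws → Via ws u w → Via ws w v → Via ws u v
  Via-trans (here refl) p              q              = inj₂ ([ id , proj₁ ]′ p , [ id , proj₂ ]′ q)
  Via-trans (there w∈)  (inj₁ p)       (inj₁ q)       = inj₁ (Via-trans w∈ p q)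
  Via-trans (there w∈)  (inj₁ p)       (inj₂ (q , r)) = inj₂ (Via-trans w∈ p q , r)
  Via-trans (there w∈)  (inj₂ (p , q)) (inj₁ r)       = inj₂ (p , Via-trans w∈ q r)
  Via-trans (there w∈)  (inj₂ (p , _)) (inj₂ (_ , r)) = inj₂ (p , r)

  Star⇒Via : ∀ {u v} → Star (Adj G) u v → Via (allFin n) u v
  Star⇒Via ε          = Via-weaken (allFin n) (inj₁ refl)
  Star⇒Via (uw ◅ w⋯v) =
    Via-trans (∈-allFin _) (Via-weaken (allFin n) (inj₂ uw)) (Star⇒Via w⋯v)

  -- Decidable reachability makes components available as Boolean subsets and permits constructive
  -- case distinctions on connectivity.
  reachable? : ∀ u v → Dec (Star (Adj G) u v)
  reachable? u v = map′ (Via⇒Star (allFin n)) Star⇒Via (via? (allFin n) u v)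

  connected? : Dec (Connected G)
  connected? = all? λ u → all? (reachable? u)

  unreachable-pair : ¬ Connected G → ∃₂ λ u v → ¬ Star (Adj G) u v
  unreachable-pair ¬conn
    with u , ¬all ← ¬∀⟶∃¬ n _ (λ u → all? (reachable? u)) ¬conn
    with v , ¬u⋯v ← ¬∀⟶∃¬ n _ (reachable? u) ¬all = u , v , ¬u⋯v

  component : Fin n → Subset n
  component v = tabulate (λ u → ⌊ reachable? v u ⌋)

  ∈-component⇔ : ∀ {v u} → (u ∈ component v) ⇔ Star (Adj G) v u
  ∈-component⇔ {v} {u} = mk⇔
    (λ u∈ → toWitness {a? = reachable? v u} (to ∈-tabulate u∈))
    (λ v⋯u → from ∈-tabulate (fromWitness {a? = reachable? v u} v⋯u))

  component-isComponent : ∀ v → IsComponent G (component v)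
  component-isComponent v = v , λ u → ∈-component⇔

  component-unique : ∀ {C} (isC : IsComponent G C) → C ≡ component (proj₁ isC)
  component-unique (v , C⇔) = ⊆-antisym (λ u∈ → from ∈-component⇔ (to (C⇔ _) u∈))
                                        (λ u∈ → from (C⇔ _) (to ∈-component⇔ u∈))

open Reachability
  using (reachable?; connected?; unreachable-pair; component; ∈-component⇔; component-isComponent; component-unique)

module _ {n : ℕ} where

  open DecMembership (_≟_ {n}) using (_∈?_)

  ≢⇒∉[] : ∀ {x y : Fin n} → x ≢ y → x ∉ˡ y ∷ []
  ≢⇒∉[] x≢y (here x≡y) = x≢y x≡y

  Star-sym : ∀ (G : Graph n) {u v} → Star (Adj G) u v → Star (Adj G) v u
  Star-sym G = reverse (Adj-sym G)

  -- The local form of the size condition for 1-extra cuts: every component has more than one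
  -- vertex.
  NoIsolated : Graph n → Set
  NoIsolated G = ∀ v → ∃ (Adj G v)

  NoIsolated⇒large : ∀ {G : Graph n} → NoIsolated G → ∀ C → IsComponent G C → 1 < ∣ C ∣
  NoIsolated⇒large {G} noIso C (v , C⇔) with noIso v
  ... | w , vw = length≤∣∣ C
    (∉⇒Unique-∷ (≢⇒∉[] (Adj⇒≢ G vw)) (∉⇒Unique-∷ (λ ()) []))
    λ { (here refl)         → from (C⇔ v) ε
      ; (there (here refl)) → from (C⇔ w) (vw ◅ ε) }

  large⇒NoIsolated : ∀ {G : Graph n} → (∀ C → IsComponent G C → 1 < ∣ C ∣) → NoIsolated G
  large⇒NoIsolated {G} large v with any? (λ w → T? (adj G v w))
  ... | yes v~w = v~w
  ... | no ¬v~w = contradiction (∣∣≤length (component G v) only-v)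
                    (ℕ.<⇒≱ (large (component G v) (component-isComponent G v)))
    where
    only-v : ∀ {z} → z ∈ component G v → z ∈ˡ v ∷ []
    only-v z∈ with to (∈-component⇔ G) z∈
    ... | ε      = here refl
    ... | vw ◅ _ = contradiction (_ , vw) ¬v~w

  -- Without a neighbour of `a` the component would be a singleton; a vertex besides `a` and `b`
  -- would raise its cardinality to 3.
  pair-component : ∀ {G : Graph n} {a} → ∣ component G a ∣ ≡ 2 →
                   ∃ λ b → Adj G a b × (∀ {z} → z ∈ component G a → z ≡ a ⊎ z ≡ b)
  pair-component {G} {a} ∣C∣≡2 with any? (λ b → T? (adj G a b))
  ... | no ¬a~b = contradiction (subst (_≤ⁿ 1) ∣C∣≡2 (∣∣≤length (component G a) only-a)) (ℕ.<⇒≱ ℕ.≤-refl)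
    where
    only-a : ∀ {z} → z ∈ component G a → z ∈ˡ a ∷ []
    only-a z∈ with to (∈-component⇔ G) z∈
    ... | ε      = here refl
    ... | ab ◅ _ = contradiction (_ , ab) ¬a~b
  ... | yes (b , ab) = b , ab , a-or-b
    where
    a-or-b : ∀ {z} → z ∈ component G a → z ≡ a ⊎ z ≡ b
    a-or-b {z} z∈ = decidable-stable ((z ≟ a) ⊎-dec (z ≟ b)) λ neither →
      contradiction
        (subst (3 ≤ⁿ_) ∣C∣≡2 (length≤∣∣ {xs = z ∷ a ∷ b ∷ []} (component G a)
          (∉⇒Unique-∷ (λ { (here z≡a) → neither (inj₁ z≡a) ; (there (here z≡b)) → neither (inj₂ z≡b) })
            (∉⇒Unique-∷ (≢⇒∉[] (Adj⇒≢ G ab)) (∉⇒Unique-∷ (λ ()) [])))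
          λ { (here refl) → z∈
            ; (there (here refl)) → from (∈-component⇔ G) ε
            ; (there (there (here refl))) → from (∈-component⇔ G) (ab ◅ ε) }))
        (ℕ.<⇒≱ ℕ.≤-refl)

  -- Extra edge cuts

  -- Two mutually unreachable vertices have disjoint components, each with at least three vertices.
  extraCut⇒6≤order : ∀ {G F : Graph n} → IsExtraEdgeCut 2 G F → 6 ≤ⁿ n
  extraCut⇒6≤order {G} {F} cut with a , b , ¬a⋯b ← unreachable-pair (G ─ᴱ F) (IsExtraEdgeCut.disconnected cut) =
    ℕ.≤-trans (ℕ.+-mono-≤ (3≤ a) (3≤ b))
      (subst (_≤ⁿ n) (length-++ (members (component H a)))
        (length≤order (Unique.++⁺ (members-unique (component H a)) (members-unique (component H b)) disjoint)))
    where
    H = G ─ᴱ F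
    3≤ : ∀ v → 3 ≤ⁿ length (members (component H v))
    3≤ v = subst (3 ≤ⁿ_) (sym (length-members (component H v)))
             (IsExtraEdgeCut.large cut (component H v) (component-isComponent H v))
    disjoint : Disjoint (members (component H a)) (members (component H b))
    disjoint (z∈a , z∈b) = ¬a⋯b (to (∈-component⇔ H) (∈-members⁻ z∈a)
                                  ◅◅ Star-sym H (to (∈-component⇔ H) (∈-members⁻ z∈b)))

  -- One of two mutually unreachable vertices lies outside the component of `z`; it has a neighbour
  -- there, since no vertex is isolated.
  extraCut⇒edge-avoiding : ∀ {G F : Graph n} → IsExtraEdgeCut 1 G F →
                           ∀ z → ∃₂ λ x y → Adj G x y × x ≢ z × y ≢ z
  extraCut⇒edge-avoiding {G} {F} cut z = avoiding
    where
    H = G ─ᴱ F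
    unreachable-from : ∀ {x} → ¬ Star (Adj H) x z → ∃₂ λ x y → Adj G x y × x ≢ z × y ≢ z
    unreachable-from {x} ¬x⋯z with y , xy ← large⇒NoIsolated {G = H} (IsExtraEdgeCut.large cut) x =
      x , y , proj₁ (─-adj⁻ G F xy) , (λ { refl → ¬x⋯z ε }) , (λ { refl → ¬x⋯z (xy ◅ ε) })
    avoiding : ∃₂ λ x y → Adj G x y × x ≢ z × y ≢ z
    avoiding with a , b , ¬a⋯b ← unreachable-pair H (IsExtraEdgeCut.disconnected cut) | reachable? H a z
    ... | no ¬a⋯z = unreachable-from ¬a⋯z
    ... | yes a⋯z = unreachable-from λ b⋯z → ¬a⋯b (a⋯z ◅◅ Star-sym H b⋯z)

  IsExtraEdgeCut-weaken : ∀ {h k} {G F : Graph n} → h ≤ⁿ k → IsExtraEdgeCut k G F → IsExtraEdgeCut h G F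
  IsExtraEdgeCut-weaken h≤k cut = record
    { subset       = IsExtraEdgeCut.subset cut
    ; disconnected = IsExtraEdgeCut.disconnected cut
    ; large        = λ C isC → ℕ.≤-<-trans h≤k (IsExtraEdgeCut.large cut C isC)
    }

  -- A minimum 2-extra cut is also 1-extra, which gives `ξ G ≤ λ″`. Equality would make it a λ′-cut,
  -- and some component would have exactly two vertices instead of at least three.
  super⇒ξ<λ″ : ∀ {G : Graph n} {λ″} → Super-λ′ G → λ⟨ 2 ⟩ G ≔ λ″ → ξ G < λ″
  super⇒ξ<λ″ {G} super ((F , cut , refl) , _) =
    ℕ.≤∧≢⇒< (proj₂ λ′≡ξ F cut₁) λ ξ≡size →
      let C , isC , ∣C∣≡2 = isolatesEdge F (cut₁ , subst (λ⟨ 1 ⟩ G ≔_) ξ≡size λ′≡ξ)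
      in ℕ.<⇒≢ (IsExtraEdgeCut.large cut C isC) (sym ∣C∣≡2)
    where
    open Super-λ′ super
    cut₁ : IsExtraEdgeCut 1 G F
    cut₁ = IsExtraEdgeCut-weaken (s≤s z≤n) cut

  -- Since u v itself is counted in both degrees, edgeDegree counts the edges
  -- with exactly one end in {u , v}.
  edgeDegree≤size : ∀ {G S : Graph n} {u v} → Adj G u v → ¬ Adj S u v →
    (∀ {x w} → x ≡ u ⊎ x ≡ v → Outside u v w → Adj G x w → Adj S x w) →
    edgeDegree G (u , v) ≤ⁿ size S
  edgeDegree≤size {G} {S} {u} {v} uv ¬uvS G⊆S = ℕ.m≤n+o⇒m∸n≤o _ 2 (begin
    degree G u + degree G v             ≤⟨ ℕ.+-mono-≤
                                             (degree≤suc G S λ uw w≢v → G⊆S (inj₁ refl) (Adj⇒≢ G uw ∘ sym , w≢v) uw)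
                                             (degree≤suc G S λ vw w≢u → G⊆S (inj₂ refl) (w≢u , Adj⇒≢ G vw ∘ sym) vw) ⟩
    suc (degree S u) + suc (degree S v) ≡⟨ cong suc (ℕ.+-suc (degree S u) (degree S v)) ⟩
    2 + (degree S u + degree S v)       ≤⟨ ℕ.+-monoʳ-≤ 2 (degree+degree≤size S (Adj⇒≢ G uv) ¬uvS) ⟩
    2 + size S                          ∎)
    where open ℕ.≤-Reasoning

  -- The stars of `u` and `v` in `S` cover `S`, and each of them lacks the edge `u v` present in
  -- `G`; this accounts for the 2.
  size≤edgeDegree : ∀ {G S : Graph n} {u v} → S ⊆ᴱ G → Adj G u v → ¬ Adj S u v →
    (∀ {x y} → Adj S x y → Outside u v x → ¬ Outside u v y) →
    size S ≤ⁿ edgeDegree G (u , v)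
  size≤edgeDegree {G} {S} {u} {v} S⊆G uv ¬uvS meets = ℕ.m+n≤o⇒m≤o∸n (size S) (begin
    size S + 2                          ≡⟨ ℕ.+-comm (size S) 2 ⟩
    2 + size S                          ≤⟨ ℕ.+-monoʳ-≤ 2 (size≤degree+degree S meets) ⟩
    2 + (degree S u + degree S v)       ≡⟨ cong suc (ℕ.+-suc (degree S u) (degree S v)) ⟨
    suc (degree S u) + suc (degree S v) ≤⟨ ℕ.+-mono-≤
                                             (degree-mono-< S G (S⊆G _ _) ¬uvS uv)
                                             (degree-mono-< S G (S⊆G _ _) (¬uvS ∘ Adj-sym S) (Adj-sym G uv)) ⟩
    degree G u + degree G v             ∎)
    where open ℕ.≤-Reasoning

  -- This dichotomy serves twice: it bounds every 1-extra cut of `G ─ᴱ F` from below, and it forces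
  -- a component with two vertices once the second alternative is excluded by size.
  small-component⊎large-cut : ∀ {G F S : Graph n} {λ″} → λ⟨ 2 ⟩ G ≔ λ″ → F ⊆ᴱ G →
    IsExtraEdgeCut 1 (G ─ᴱ F) S →
    ((∃ λ C → IsComponent (G ─ᴱ F ─ᴱ S) C × ∣ C ∣ ≡ 2) × ξ (G ─ᴱ F) ≤ⁿ size S) ⊎ λ″ ≤ⁿ size F + size S
  small-component⊎large-cut {G} {F} {S} (_ , minimal) F⊆G cut
    with any? (λ v → ∣ component (G ─ᴱ F ─ᴱ S) v ∣ ℕ.≟ 2)
  ... | yes (a , ∣C∣≡2) = inj₁ ((C , component-isComponent H a , ∣C∣≡2) , isolating)
    where
    H = G ─ᴱ F ─ᴱ S
    C = component H a
    isolating : ξ (G ─ᴱ F) ≤ⁿ size S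
    isolating with b , ab , a-or-b ← pair-component {G = H} ∣C∣≡2 =
      ℕ.≤-trans (ξ≤edgeDegree (G ─ᴱ F) (proj₁ ab⁻))
                (edgeDegree≤size {G = G ─ᴱ F} {S} (proj₁ ab⁻) (proj₂ ab⁻) leaving)
      where
      ab⁻ = ─-adj⁻ (G ─ᴱ F) S ab
      -- An edge leaving the pair and surviving the removal of `S` would bring a third vertex into
      -- the component.
      leaving : ∀ {x w} → x ≡ a ⊎ x ≡ b → Outside a b w → Adj (G ─ᴱ F) x w → Adj S x w
      leaving {x} {w} x∈ab (w≢a , w≢b) xw = decidable-stable (T? (adj S x w)) λ ¬xwS →
        [ w≢a , w≢b ]′ (a-or-b (from (∈-component⇔ H)
          (a⋯x x∈ab ◅◅ (─-adj⁺ (G ─ᴱ F) S xw ¬xwS ◅ ε))))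
        where
        a⋯x : x ≡ a ⊎ x ≡ b → Star (Adj H) a x
        a⋯x (inj₁ refl) = ε
        a⋯x (inj₂ refl) = ab ◅ ε
  ... | no ¬two = inj₂ (ℕ.≤-trans (minimal (F ∪ᴱ S) union-cut) (size-∪≤ F S))
    where
    H = G ─ᴱ F ─ᴱ S
    H⇒H∪ : ∀ {u v} → Adj H u v → Adj (G ─ᴱ (F ∪ᴱ S)) u v
    H⇒H∪ {u} {v} uv with uv′ , ¬S ← ─-adj⁻ (G ─ᴱ F) S uv with uvG , ¬F ← ─-adj⁻ G F uv′ =
      ─-adj⁺ G (F ∪ᴱ S) uvG ([ ¬F , ¬S ]′ ∘ to (T-∨ {adj F u v}))
    H∪⇒H : ∀ {u v} → Adj (G ─ᴱ (F ∪ᴱ S)) u v → Adj H u v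
    H∪⇒H {u} {v} uv with uvG , ¬∪ ← ─-adj⁻ G (F ∪ᴱ S) uv =
      ─-adj⁺ (G ─ᴱ F) S (─-adj⁺ G F uvG (¬∪ ∘ from (T-∨ {adj F u v}) ∘ inj₁))
                        (¬∪ ∘ from (T-∨ {adj F u v}) ∘ inj₂)
    union-cut : IsExtraEdgeCut 2 G (F ∪ᴱ S)
    union-cut = record
      { subset       = λ u v uv → [ F⊆G u v , proj₁ ∘ ─-adj⁻ G F ∘ IsExtraEdgeCut.subset cut u v ]′
                                    (to (T-∨ {adj F u v}) uv)
      ; disconnected = λ conn → IsExtraEdgeCut.disconnected cut λ u v → Star.map H∪⇒H (conn u v)
      ; large        = λ C (v , C⇔) →
          let isC : IsComponent H C
              isC = v , λ u → mk⇔ (Star.map H∪⇒H ∘ to (C⇔ u)) (from (C⇔ u) ∘ Star.map H⇒H∪)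
          -- Since `S` is 1-extra, each component has at least two vertices, and none has exactly
          -- two.
          in ℕ.≤∧≢⇒< (IsExtraEdgeCut.large cut C isC)
               λ 2≡∣C∣ → ¬two (v , trans (cong ∣_∣ (sym (component-unique H isC))) (sym 2≡∣C∣))
      }

  -- Cutting along the set of all vertices that keep a neighbour after u and v
  -- are deleted isolates no vertex and removes only edges at u or v.
  disjoint-edges⇒cut : ∀ {G : Graph n} → NoIsolated G → ∀ {u v x y} → Adj G u v →
    Adj G x y → Outside u v x → Outside u v y →
    ∃ λ S → IsExtraEdgeCut 1 G S × size S ≤ⁿ edgeDegree G (u , v)
  disjoint-edges⇒cut {G} noIso {u} {v} {x} {y} uv xy out-x out-y =
    S , cut , size≤edgeDegree {G = G} {S} (λ p q → proj₁ ∘ boundary-adj⁻ G c) uv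
                (λ uvS → proj₂ (boundary-adj⁻ G c uvS) (trans (c-inside u∉) (sym (c-inside v∉))))
                -- An edge avoiding `u` and `v` has both ends kept, so it does not cross the cut.
                (λ pqS out-p out-q → let pq , cp≢cq = boundary-adj⁻ G c pqS in
                  cp≢cq (trans (c-kept out-p pq out-q) (sym (c-kept out-q (Adj-sym G pq) out-p))))
    where
    Kept : Fin n → Set
    Kept z = Outside u v z × ∃ λ w → Adj G z w × Outside u v w
    kept? : ∀ z → Dec (Kept z)
    kept? z = outside? u v z ×-dec any? λ w → T? (adj G z w) ×-dec outside? u v w
    c : Fin n → Bool
    c z = does (kept? z)
    S = boundary G c
    c-kept : ∀ {p q} → Outside u v p → Adj G p q → Outside u v q → c p ≡ true
    c-kept {p} out-p pq out-q = dec-true (kept? p) (out-p , _ , pq , out-q)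
    c-inside : ∀ {z} → ¬ Outside u v z → c z ≡ false
    c-inside {z} ¬out = dec-false (kept? z) (¬out ∘ proj₁)
    u∉ : ¬ Outside u v u
    u∉ (u≢u , _) = u≢u refl
    v∉ : ¬ Outside u v v
    v∉ (_ , v≢v) = v≢v refl
    remains : ∀ {p q} → Adj G p q → c p ≡ c q → Adj (G ─ᴱ S) p q
    remains pq cp≡cq = ─-adj⁺ G S pq λ pqS → proj₂ (boundary-adj⁻ G c pqS) cp≡cq
    c-invariant : ∀ {p q} → Star (Adj (G ─ᴱ S)) p q → c p ≡ c q
    c-invariant ε = refl
    c-invariant {p} (_◅_ {j = r} pr r⋯q) with pr⁺ , ¬prS ← ─-adj⁻ G S pr =
      trans (decidable-stable (c p ≟ᵇ c r) λ cp≢cr → ¬prS (boundary-adj⁺ G c pr⁺ cp≢cr))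
            (c-invariant r⋯q)
    -- Every vertex retains a neighbour on its own side: `u` and `v` retain each other, a kept
    -- vertex retains a kept one, and any other vertex has only `u` and `v` as neighbours, on its
    -- own side.
    noIso′ : NoIsolated (G ─ᴱ S)
    noIso′ z with outside? u v z
    ... | no ¬out with ¬Outside⇒ ¬out
    ...   | inj₁ refl = v , remains uv (trans (c-inside u∉) (sym (c-inside v∉)))
    ...   | inj₂ refl = u , remains (Adj-sym G uv) (trans (c-inside v∉) (sym (c-inside u∉)))
    noIso′ z | yes out-z with kept? z
    ... | yes (_ , w , zw , out-w) =
      w , remains zw (trans (c-kept out-z zw out-w) (sym (c-kept out-w (Adj-sym G zw) out-z)))
    ... | no ¬kept with w , zw ← noIso z =
      w , remains zw (trans (dec-false (kept? z) ¬kept)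
                            (sym (c-inside λ out-w → ¬kept (out-z , w , zw , out-w))))
    cut : IsExtraEdgeCut 1 G S
    cut = record
      { subset       = λ p q → proj₁ ∘ boundary-adj⁻ G c
      ; disconnected = λ conn → case trans (sym (c-kept out-x xy out-y))
                                  (trans (c-invariant (conn x u)) (c-inside u∉)) of λ ()
      ; large        = NoIsolated⇒large {G = G ─ᴱ S} noIso′
      }

  -- Deleting fewer than δ edges

  -- Isolating `v` would require all of its edges, at least `δ G` many, to lie in `F`.
  NoIsolated-─ : ∀ {G F : Graph n} → size F < δ G → NoIsolated (G ─ᴱ F)
  NoIsolated-─ {G} {F} ∣F∣<δ v = positive-degree⇒neighbour (G ─ᴱ F) v
    (ℕ.+-cancelʳ-< (degree F v) 0 (degree (G ─ᴱ F) v) (begin-strict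
      degree F v                         ≤⟨ degree≤size F v ⟩
      size F                             <⟨ ∣F∣<δ ⟩
      δ G                                ≤⟨ δ≤degree G v ⟩
      degree G v                         ≤⟨ degree≤degree─+degree G F v ⟩
      degree (G ─ᴱ F) v + degree F v ∎))
    where open ℕ.≤-Reasoning

  -- If all remaining edges met `u`, then `x y` would lie in `F`, and any vertex besides `u`, `x`
  -- and `y` would force `F` to have at least `δ G` edges. The graph would then have at most three
  -- vertices.
  edge-avoiding-─ : ∀ {G F : Graph n} → 4 ≤ⁿ n → size F < δ G → ∀ {u} →
    (∃₂ λ x y → Adj G x y × x ≢ u × y ≢ u) → ∃₂ λ x y → Adj (G ─ᴱ F) x y × x ≢ u × y ≢ u
  edge-avoiding-─ {G} {F} 4≤n ∣F∣<δ {u} (x , y , xy , x≢u , y≢u)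
    with any? (λ p → any? λ q → T? (adj (G ─ᴱ F) p q) ×-dec ¬? (p ≟ u) ×-dec ¬? (q ≟ u))
  ... | yes found = found
  ... | no ¬found = contradiction (order≤length all∈) (ℕ.<⇒≱ 4≤n)
    where
    to-u : ∀ {p q} → Adj (G ─ᴱ F) p q → p ≢ u → q ≡ u
    to-u {p} {q} pq p≢u = decidable-stable (q ≟ u) λ q≢u → ¬found (p , q , pq , p≢u , q≢u)
    xyF : Adj F x y
    xyF = decidable-stable (T? (adj F x y)) λ ¬xyF → y≢u (to-u (─-adj⁺ G F xy ¬xyF) x≢u)
    -- A fourth vertex w has all but one of its edges in F, which with x y makes δ.
    all∈ : ∀ w → w ∈ˡ u ∷ x ∷ y ∷ []
    all∈ w = decidable-stable (w ∈? u ∷ x ∷ y ∷ []) λ w∉ →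
      ℕ.<⇒≱ ∣F∣<δ (begin
        δ G                                ≤⟨ δ≤degree G w ⟩
        degree G w                         ≤⟨ degree≤degree─+degree G F w ⟩
        degree (G ─ᴱ F) w + degree F w     ≤⟨ ℕ.+-monoˡ-≤ (degree F w)
                                                (degree≤ (G ─ᴱ F) w {u ∷ []} λ wz → here (to-u wz λ w≡u → w∉ (here w≡u))) ⟩
        1 + degree F w                     ≤⟨ degree<size F xyF (λ w≡x → w∉ (there (here w≡x)))
                                                              (λ w≡y → w∉ (there (there (here w≡y)))) ⟩
        size F                             ∎)
      where open ℕ.≤-Reasoning


  -- If every remaining edge met {`u`, `v`}, then, no vertex being isolated, the neighbours of `u`
  -- and `v` would exhaust the vertices, while minimality limits both degrees to 2.
  minimum-edge⇒disjoint-edge : ∀ {G F : Graph n} → 6 ≤ⁿ n → size F < δ G →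
    (∀ z → ∃₂ λ x y → Adj G x y × x ≢ z × y ≢ z) →
    ∀ {u v} → Adj (G ─ᴱ F) u v → edgeDegree (G ─ᴱ F) (u , v) ≡ ξ (G ─ᴱ F) →
    ∃₂ λ x y → Adj (G ─ᴱ F) x y × Outside u v x × Outside u v y
  minimum-edge⇒disjoint-edge {G} {F} 6≤n ∣F∣<δ avoiding {u} {v} uv uv-min
    with any? (λ x → any? λ y → T? (adj (G ─ᴱ F) x y) ×-dec outside? u v x ×-dec outside? u v y)
  ... | yes found = found
  ... | no ¬found = contradiction n≤4 (ℕ.<⇒≱ (ℕ.≤-trans (ℕ.n≤1+n 5) 6≤n))
    where
    H = G ─ᴱ F
    Covering : Fin n → Fin n → Set
    Covering p q = ∀ {x y} → Adj H x y → Outside p q x → ¬ Outside p q y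

    noIso : NoIsolated H
    noIso = NoIsolated-─ {G} {F} ∣F∣<δ

    -- Some edge q y avoids p, and all neighbours of y are among p and q;
    -- comparing it with p q gives degree p ≤ degree y ≤ 2.
    degree≤2 : ∀ {p q} → edgeDegree H (p , q) ≡ ξ H → Covering p q → degree H p ≤ⁿ 2
    degree≤2 {p} {q} pq-min covering = at-q
      (edge-avoiding-─ {G} {F} (ℕ.≤-trans (ℕ.m≤n+m 4 2) 6≤n) ∣F∣<δ (avoiding p))
      where
      open ℕ.≤-Reasoning
      via-y : ∀ {y} → Adj H q y → y ≢ p → degree H p ≤ⁿ 2
      via-y {y} qy y≢p = ℕ.+-cancelˡ-≤ (degree H q) (degree H p) 2 (begin
        degree H q + degree H p           ≡⟨ ℕ.+-comm (degree H q) (degree H p) ⟩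
        degree H p + degree H q           ≤⟨ ℕ.m≤n+m∸n (degree H p + degree H q) 2 ⟩
        2 + edgeDegree H (p , q)          ≤⟨ ℕ.+-monoʳ-≤ 2
                                                 (subst (_≤ⁿ edgeDegree H (q , y)) (sym pq-min) (ξ≤edgeDegree H qy)) ⟩
        -- Here the truncated subtraction must be exact, hence the positive degrees of both ends.
        2 + edgeDegree H (q , y)          ≡⟨ ℕ.m+[n∸m]≡n (ℕ.+-mono-≤ (neighbour⇒positive-degree H qy)
                                                             (neighbour⇒positive-degree H (Adj-sym H qy))) ⟩
        degree H q + degree H y           ≤⟨ ℕ.+-monoʳ-≤ (degree H q) (degree≤ H y {p ∷ q ∷ []} N⊆) ⟩
        degree H q + 2                    ∎)
        where
        N⊆ : ∀ {w} → Adj H y w → w ∈ˡ p ∷ q ∷ []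
        N⊆ yw with ¬Outside⇒ (covering yw (y≢p , Adj⇒≢ H qy ∘ sym))
        ... | inj₁ w≡p = here w≡p
        ... | inj₂ w≡q = there (here w≡q)
      at-q : (∃₂ λ x y → Adj H x y × x ≢ p × y ≢ p) → degree H p ≤ⁿ 2
      at-q (x , y , xy , x≢p , y≢p) with x ≟ q
      ... | yes refl = via-y xy y≢p
      ... | no  x≢q with ¬Outside⇒ (covering xy (x≢p , x≢q))
      ...   | inj₁ y≡p  = contradiction y≡p y≢p
      ...   | inj₂ refl = via-y (Adj-sym H xy) x≢p

    covering : Covering u v
    covering xy out-x out-y = ¬found (_ , _ , xy , out-x , out-y)

    vu-min : edgeDegree H (v , u) ≡ ξ H
    vu-min = trans (cong (_∸ 2) (ℕ.+-comm (degree H v) (degree H u))) uv-min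

    n≤4 : n ≤ⁿ 4
    n≤4 = begin
      n                                                 ≤⟨ order≤length all∈ ⟩
      length (neighbours H u ++ neighbours H v)         ≡⟨ length-++ (neighbours H u) ⟩
      length (neighbours H u) + length (neighbours H v) ≡⟨ cong₂ _+_ (length-neighbours H u) (length-neighbours H v) ⟩
      degree H u + degree H v                           ≤⟨ ℕ.+-mono-≤ (degree≤2 uv-min covering)
                                                           (degree≤2 vu-min λ xy (x≢v , x≢u) (y≢v , y≢u) →
                                                             covering xy (x≢u , x≢v) (y≢u , y≢v)) ⟩
      4                                                 ∎
      where
      open ℕ.≤-Reasoning
      all∈ : ∀ z → z ∈ˡ neighbours H u ++ neighbours H v
      all∈ z with outside? u v z
      ... | no ¬out with ¬Outside⇒ ¬out
      ...   | inj₁ refl = ∈-++⁺ʳ (neighbours H u) (∈-neighbours⁺ H (Adj-sym H uv))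
      ...   | inj₂ refl = ∈-++⁺ˡ (∈-neighbours⁺ H uv)
      all∈ z | yes out with w , zw ← noIso z with ¬Outside⇒ (covering zw out)
      ...   | inj₁ refl = ∈-++⁺ˡ (∈-neighbours⁺ H (Adj-sym H zw))
      ...   | inj₂ refl = ∈-++⁺ʳ (neighbours H u) (∈-neighbours⁺ H (Adj-sym H zw))

  -- A disconnecting `F` isolates no vertex, so it is a 1-extra cut and `ξ G ≤ size F`. Together
  -- with `2δ ≤ 2 + ξ` and `size F < δ` this leaves only the empty `F`, which does not disconnect
  -- `G`.
  super⇒Connected-─ : ∀ {G F : Graph n} → Super-λ′ G → F ⊆ᴱ G → size F < δ G → Connected (G ─ᴱ F)
  super⇒Connected-─ {G} {F} super F⊆G ∣F∣<δ = decidable-stable (connected? (G ─ᴱ F)) λ ¬conn →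
    let cut : IsExtraEdgeCut 1 G F
        cut = record
          { subset       = F⊆G
          ; disconnected = ¬conn
          ; large        = NoIsolated⇒large {G = G ─ᴱ F} (NoIsolated-─ {G} {F} ∣F∣<δ)
          }
        a , _ , _   = unreachable-pair (G ─ᴱ F) ¬conn
        _ , ab      = NoIsolated-─ {G} {F} ∣F∣<δ a
        u , v , uv , uv-min = ξ-attained G (proj₁ (─-adj⁻ G F ab))
        open ℕ.≤-Reasoning
        2δ≤ : δ G + δ G ≤ⁿ 2 + size F
        2δ≤ = begin
          δ G + δ G               ≤⟨ ℕ.+-mono-≤ (δ≤degree G u) (δ≤degree G v) ⟩
          degree G u + degree G v ≤⟨ ℕ.m≤n+m∸n (degree G u + degree G v) 2 ⟩
          2 + edgeDegree G (u , v) ≡⟨ cong (λ k → 2 + k) uv-min ⟩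
          2 + ξ G                 ≤⟨ ℕ.+-monoʳ-≤ 2 (proj₂ λ′≡ξ F cut) ⟩
          2 + size F              ∎
        F-empty : ∀ {x y} → ¬ Adj F x y
        F-empty xy = ℕ.<⇒≱ (begin-strict
          2 + size F                <⟨ s≤s (ℕ.+-monoˡ-≤ (suc (size F)) (Adj⇒0<size F xy)) ⟩
          suc (size F) + suc (size F) ≤⟨ ℕ.+-mono-≤ ∣F∣<δ ∣F∣<δ ⟩
          δ G + δ G                 ∎) 2δ≤
    in ¬conn λ x y → Star.map (λ pq → ─-adj⁺ G F pq F-empty) (proj₁ λ′-connected x y)
    where open Super-λ′ super


  -- The last premise makes every cut of the second kind in `small-component⊎large-cut` strictly
  -- larger than `ξ (G ─ᴱ F)`, while a cut `S₀` built around a minimum edge attains that value.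
  super-─ : ∀ {G F : Graph n} {λ″} → λ⟨ 2 ⟩ G ≔ λ″ → Super-λ′ G → F ⊆ᴱ G → size F < δ G →
            size F + ξ (G ─ᴱ F) < λ″ → Super-λ′ (G ─ᴱ F)
  super-─ {G} {F} {λ″} λ″-min@((F₂ , cut₂ , _) , _) super F⊆G ∣F∣<δ ∣F∣+ξ<λ″ = record
    { λ′-connected = super⇒Connected-─ {G = G} {F} super F⊆G ∣F∣<δ , S₀ , cut₀
    ; λ′≡ξ         = (S₀ , cut₀ , ℕ.≤-antisym ∣S₀∣≤ξ (minimal S₀ cut₀)) , minimal
    -- A minimum cut is no larger than `S₀`, which rules out the alternative with size above `ξ H`.
    ; isolatesEdge = λ S (cut , _ , S-min) →
        [ proj₁ , (λ λ″≤ → contradiction (ℕ.≤-trans (S-min S₀ cut₀) ∣S₀∣≤ξ) (ℕ.<⇒≱ (large-cut⇒ξ< {S} λ″≤))) ]′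
        (small-component⊎large-cut {G = G} {F} {S} λ″-min F⊆G cut)
    }
    where
    H = G ─ᴱ F

    large-cut⇒ξ< : ∀ {S : Graph n} → λ″ ≤ⁿ size F + size S → ξ H < size S
    large-cut⇒ξ< {S} λ″≤ = ℕ.+-cancelˡ-< (size F) (ξ H) (size S) (ℕ.<-≤-trans ∣F∣+ξ<λ″ λ″≤)

    minimal : ∀ S → IsExtraEdgeCut 1 H S → ξ H ≤ⁿ size S
    minimal S cut = [ proj₂ , ℕ.<⇒≤ ∘ large-cut⇒ξ< {S} ]′ (small-component⊎large-cut {G = G} {F} {S} λ″-min F⊆G cut)

    witness : ∃ λ S → IsExtraEdgeCut 1 H S × size S ≤ⁿ ξ H
    witness =
      -- The cut `F₂` attaining `λ″` supplies a vertex, and thereby an edge of `H`; it also gives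
      -- the order bound and the edges avoiding each vertex.
      let a , _ , _                      = unreachable-pair (G ─ᴱ F₂) (IsExtraEdgeCut.disconnected cut₂)
          _ , ab                         = NoIsolated-─ {G = G} {F} ∣F∣<δ a
          u , v , uv , uv-min            = ξ-attained H ab
          x , y , xy , out-x , out-y     = minimum-edge⇒disjoint-edge {G = G} {F}
            (extraCut⇒6≤order {G = G} {F₂} cut₂) ∣F∣<δ
            (extraCut⇒edge-avoiding {G = G} {F₂} (IsExtraEdgeCut-weaken (s≤s z≤n) cut₂)) uv uv-min
          S , cut , ∣S∣≤                 = disjoint-edges⇒cut {G = H} (NoIsolated-─ {G = G} {F} ∣F∣<δ) uv xy out-x out-y
      in S , cut , subst (size S ≤ⁿ_) uv-min ∣S∣≤

    S₀ : Graph n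
    S₀ = proj₁ witness

    cut₀ : IsExtraEdgeCut 1 H S₀
    cut₀ = proj₁ (proj₂ witness)

    ∣S₀∣≤ξ : size S₀ ≤ⁿ ξ H
    ∣S₀∣≤ξ = proj₂ (proj₂ witness)

  -- The minimum edge-degree after deletion

  edgeDegree-─≤ : ∀ (G F : Graph n) e → edgeDegree (G ─ᴱ F) e ≤ⁿ edgeDegree G e
  edgeDegree-─≤ G F (u , v) = ℕ.∸-monoˡ-≤ 2 (ℕ.+-mono-≤
    (degree-mono (G ─ᴱ F) G u (proj₁ ∘ ─-adj⁻ G F)) (degree-mono (G ─ᴱ F) G v (proj₁ ∘ ─-adj⁻ G F)))

  surviving-minimum-edge⇒ξ≤ : ∀ {G F : Graph n} {u v} → Adj G u v → ¬ Adj F u v →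
    edgeDegree G (u , v) ≡ ξ G → ξ (G ─ᴱ F) ≤ⁿ ξ G
  surviving-minimum-edge⇒ξ≤ {G = G} {F} {u} {v} uv ¬uvF uv-min = subst (ξ (G ─ᴱ F) ≤ⁿ_) uv-min
    (ℕ.≤-trans (ξ≤edgeDegree (G ─ᴱ F) (─-adj⁺ G F uv ¬uvF)) (edgeDegree-─≤ G F (u , v)))

  -- `F` has too few edges to contain all `η G` edges of minimum edge-degree, so one of them
  -- survives.
  size<η⇒ξ≤ : ∀ {G F : Graph n} → size F < η G → ξ (G ─ᴱ F) ≤ⁿ ξ G
  size<η⇒ξ≤ {G} {F} ∣F∣<η
    with any? (λ u → any? λ v → T? (adj G u v) ×-dec ¬? (T? (adj F u v)) ×-dec (edgeDegree G (u , v) ℕ.≟ ξ G))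
  ... | yes (u , v , uv , ¬uvF , uv-min) = surviving-minimum-edge⇒ξ≤ {G = G} {F} uv ¬uvF uv-min
  ... | no ¬surviving = contradiction (length-mono-⊆ (Unique.filter⁺ minimum? (edges-unique G)) ⊆F) (ℕ.<⇒≱ ∣F∣<η)
    where
    minimum? : ∀ e → Dec (edgeDegree G e ≡ ξ G)
    minimum? e = edgeDegree G e ℕ.≟ ξ G
    ⊆F : ∀ {e} → e ∈ˡ filter minimum? (edges G) → e ∈ˡ edges F
    ⊆F {u , v} e∈ with uv∈ , uv-min ← ∈-filter⁻ minimum? {xs = edges G} e∈ with u<v , uv ← ∈-edges⁻ G uv∈ =
      ∈-edges⁺ F u<v (decidable-stable (T? (adj F u v)) λ ¬uvF → ¬surviving (u , v , uv , ¬uvF , uv-min))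

  -- An edge next to an edge of F loses at least one from its edge-degree.
  edge-regular⇒ξ< : ∀ {G F : Graph n} → EdgeRegular G → F ⊆ᴱ G → size F < δ G → ∀ {x y} → Adj F x y →
                    ξ (G ─ᴱ F) < ξ G
  edge-regular⇒ξ< {G = G} {F} regular F⊆G ∣F∣<δ {x} {y} xyF
    with w , xw ← NoIsolated-─ {G = G} {F} ∣F∣<δ x = begin-strict
    ξ H                           ≤⟨ ξ≤edgeDegree H xw ⟩
    degree H x + degree H w ∸ 2   <⟨ ℕ.∸-monoˡ-< (ℕ.+-mono-<-≤
                                       (degree-mono-< H G (proj₁ ∘ ─-adj⁻ G F) (λ xyH → proj₂ (─-adj⁻ G F xyH) xyF)
                                         (F⊆G x y xyF))
                                       (degree-mono H G w (proj₁ ∘ ─-adj⁻ G F)))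
                                     -- Strictness survives truncated subtraction because the
                                     -- smaller degree sum is at least 2.
                                     (ℕ.+-mono-≤ (neighbour⇒positive-degree H xw)
                                                 (neighbour⇒positive-degree H (Adj-sym H xw))) ⟩
    degree G x + degree G w ∸ 2   ≡⟨ regular x w (proj₁ (─-adj⁻ G F xw)) ⟩
    ξ G                           ∎
    where
    open ℕ.≤-Reasoning
    H = G ─ᴱ F

  -- A nonempty `F` lowers ξ by at least one, which makes the inequality strict. For empty `F` the
  -- strictness comes from `super⇒ξ<λ″`.
  edge-regular⇒size+ξ<λ″ : ∀ {G F : Graph n} {λ″} → λ⟨ 2 ⟩ G ≔ λ″ → Super-λ′ G → EdgeRegular G →
    F ⊆ᴱ G → size F < δ G → size F + ξ G ≤ⁿ λ″ → size F + ξ (G ─ᴱ F) < λ″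
  edge-regular⇒size+ξ<λ″ {G} {F} {λ″} λ″-min@((F₂ , cut₂ , _) , _) super regular F⊆G ∣F∣<δ ∣F∣+ξ≤λ″
    with any? (λ x → any? λ y → T? (adj F x y))
  ... | yes (x , y , xyF) =
    ℕ.<-≤-trans (ℕ.+-monoʳ-< (size F) (edge-regular⇒ξ< {G = G} {F} regular F⊆G ∣F∣<δ xyF)) ∣F∣+ξ≤λ″
  ... | no F-empty = subst (λ k → k + ξ (G ─ᴱ F) < λ″) (sym ∣F∣≡0)
    (ℕ.≤-<-trans ξ≤ (super⇒ξ<λ″ super λ″-min))
    where
    ∣F∣≡0 : size F ≡ 0
    ∣F∣≡0 with edges F | ∈-edges⁻ F
    ... | []    | _   = refl
    ... | _ ∷ _ | adj = contradiction (_ , _ , proj₂ (adj (here refl))) F-empty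
    ξ≤ : ξ (G ─ᴱ F) ≤ⁿ ξ G
    ξ≤ =
      let a , _ , _           = unreachable-pair (G ─ᴱ F₂) (IsExtraEdgeCut.disconnected cut₂)
          _ , ab              = NoIsolated-─ {G = G} {F} ∣F∣<δ a
          _ , _ , uv , uv-min = ξ-attained G (proj₁ (─-adj⁻ G F ab))
      in surviving-minimum-edge⇒ξ≤ {G = G} {F} uv (λ uvF → F-empty (_ , _ , uvF)) uv-min

-- Integer bounds and the two estimates

-- The bounds of the theorem are integers and may be negative; a negative one lies below every
-- natural number, so testing natural `m` suffices.
≤ᶻ-intro : ∀ {i n} → (∀ m → + m ≤ i → m ≤ⁿ n) → i ≤ + n
≤ᶻ-intro {+ m}      bound = +≤+ (bound m ℤ.≤-refl)
≤ᶻ-intro { -[1+ m ]} bound = -≤+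

i≤j-k⇒i+k≤j : ∀ {i j} k → i ≤ j - k → i +ᶻ k ≤ j
i≤j-k⇒i+k≤j {i} {j} k i≤j-k = subst (i +ᶻ k ≤_)
  (trans (ℤ.+-assoc j (- k) k) (trans (cong (j +ᶻ_) (ℤ.+-inverseˡ k)) (ℤ.+-identityʳ j)))
  (ℤ.+-monoˡ-≤ k i≤j-k)

m≤d-1⇒m<d : ∀ {m d} → + m ≤ + d - 1ℤ → m < d
m≤d-1⇒m<d {m} {d} m≤d-1 = subst (_≤ⁿ d) (ℕ.+-comm m 1) (ℤ.drop‿+≤+ (i≤j-k⇒i+k≤j 1ℤ m≤d-1))

theorem2p4 : ∀ {n : ℕ} (G : Graph n) → λ⟨ 2 ⟩-Connected G → Super-λ′ G →
    ∀ (λ″ : ℕ) → λ⟨ 2 ⟩ G ≔ λ″ →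
    ∀ (ρ : ℕ) → ρ′ G ≔ ρ →
    (η G ≥ δ G → ((+ λ″ - + ξ G - 1ℤ) ⊓ (+ δ G - 1ℤ)) ≤ + ρ) ×
    (EdgeRegular G → ((+ λ″ - + ξ G) ⊓ (+ δ G - 1ℤ)) ≤ + ρ)
theorem2p4 {n} G _ super λ″ λ″-min ρ (_ , ρ-max) = part-i , part-ii
  where
  part-i : η G ≥ δ G → ((+ λ″ - + ξ G - 1ℤ) ⊓ (+ δ G - 1ℤ)) ≤ + ρ
  -- As `ρ` is the largest persistent value, it suffices that every natural `m` up to the bound
  -- persists.
  part-i δ≤η = ≤ᶻ-intro λ m m≤ → ρ-max m λ F F⊆G ∣F∣≤m →
    let ∣F∣<δ   = ℕ.≤-<-trans ∣F∣≤m (m≤d-1⇒m<d (ℤ.i≤j⊓k⇒i≤k (+ λ″ - + ξ G - 1ℤ) _ m≤))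
        m+1+ξ≤λ″ = ℤ.drop‿+≤+ (i≤j-k⇒i+k≤j (+ ξ G) (i≤j-k⇒i+k≤j 1ℤ (ℤ.i≤j⊓k⇒i≤j _ (+ δ G - 1ℤ) m≤)))
        -- From `size F < δ G` and `δ G ≤ η G` some minimum edge survives; the unit subtracted in
        -- the bound then gives the strict inequality.
        ξ≤      = size<η⇒ξ≤ {G = G} {F} (ℕ.<-≤-trans ∣F∣<δ δ≤η)
    in super-─ {G = G} {F} λ″-min super F⊆G ∣F∣<δ
         (ℕ.≤-trans (ℕ.+-mono-≤ (s≤s ∣F∣≤m) ξ≤) (subst (λ k → k + ξ G ≤ⁿ λ″) (ℕ.+-comm m 1) m+1+ξ≤λ″))

  part-ii : EdgeRegular G → ((+ λ″ - + ξ G) ⊓ (+ δ G - 1ℤ)) ≤ + ρ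
  part-ii regular = ≤ᶻ-intro λ m m≤ → ρ-max m λ F F⊆G ∣F∣≤m →
    let ∣F∣<δ  = ℕ.≤-<-trans ∣F∣≤m (m≤d-1⇒m<d (ℤ.i≤j⊓k⇒i≤k (+ λ″ - + ξ G) _ m≤))
        m+ξ≤λ″ = ℤ.drop‿+≤+ (i≤j-k⇒i+k≤j (+ ξ G) (ℤ.i≤j⊓k⇒i≤j _ (+ δ G - 1ℤ) m≤))
    -- The bound gives only a weak inequality here; edge-regularity supplies the missing unit.
    in super-─ {G = G} {F} λ″-min super F⊆G ∣F∣<δ
         (edge-regular⇒size+ξ<λ″ {G = G} {F} λ″-min super regular F⊆G ∣F∣<δ
           (ℕ.≤-trans (ℕ.+-monoˡ-≤ (ξ G) ∣F∣≤m) m+ξ≤λ″))
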